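{- Let $\mathcal P_1$ and $\mathcal P_2$ be two finite posets such that at least one of them has the UCTP and has at least two elements. Then $\text{sat}^*(n,\mathcal P_2*\mathcal P_1)\to\infty$ as $n\to\infty$.
   Context: A poset $\mathcal Q$ contains an induced copy of a poset $\mathcal P$ if there is an injective map $f:\mathcal P\to\mathcal Q$ with $f(x)\le f(y)$ iff $x\le y$. For a finite poset $\mathcal P$, a family $\mathcal F$ of subsets of $[n]$ (ordered by inclusion) is $\mathcal P$-saturated if $\mathcal F$ contains no induced copy of $\mathcal P$ but for every $S\subseteq[n]$ with $S\notin\mathcal F$, $\mathcal F\cup\{S\}$ contains an induced copy of $\mathcal P$; $\text{sat}^*(n,\mathcal P)$ is the minimum size of a $\mathcal P$-saturated family of subsets of $[n]$. For finite posets $\mathcal P_1,\mathcal P_2$, $\mathcal P_2*\mathcal P_1$ is the poset on the disjoint union of $\mathcal P_1$ and $\mathcal P_2$, keeping the orders within each, with every element of $\mathcal P_1$ strictly below every element of $\mathcal P_2$. In a poset, $y$ covers $x$ if $x<y$ and there is no $z$ with $x<z<y$. A poset has the unique cover twin property (UCTP) if whenever $p_2$ covers $p_1$, there exists an element $p_3$ comparable with exactly one of $p_1,p_2$. -}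

module Defs where

open import Data.Nat using (ℕ; _≤_)
open import Data.Fin using (Fin; splitAt)
open import Data.Fin.Subset using (Subset; _⊆_)
open import Data.List using (List; _∷_; length)
open import Data.List.Membership.Propositional using (_∈_; _∉_)
open import Data.List.Relation.Unary.Unique.Propositional using (Unique)
open import Data.Product using (Σ; _×_; ∃; ∃-syntax)
open import Data.Sum using (_⊎_; inj₁; inj₂)
open import Data.Unit using (⊤)
open import Data.Empty using (⊥)
open import Function.Bundles using (_⇔_)
open import Function.Definitions using (Injective)
open import Relation.Nullary using (¬_)
open import Relation.Binary.Core using (Rel)
open import Relation.Binary.Definitions using (Decidable)
open import Relation.Binary.Structures using (IsPartialOrder)
open import Relation.Binary.PropositionalEquality using (_≡_; _≢_)
open import Level using (0ℓ)

record FinPoset : Set₁ where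
  field
    size  : ℕ
    _≼_   : Rel (Fin size) 0ℓ
    isPartialOrder : IsPartialOrder _≡_ _≼_
    _≼?_  : Decidable _≼_

-- P₂ * P₁ on Fin (k₁ + k₂): the first k₁ elements form P₁, the rest P₂,
-- and every element of P₁ is strictly below every element of P₂.
starRel : ∀ {k₁ k₂} → Rel (Fin k₁) 0ℓ → Rel (Fin k₂) 0ℓ → Rel (Fin (k₁ Data.Nat.+ k₂)) 0ℓ
starRel {k₁} R₁ R₂ x y with splitAt k₁ x | splitAt k₁ y
... | inj₁ a | inj₁ b = R₁ a b
... | inj₂ a | inj₂ b = R₂ a b
... | inj₁ _ | inj₂ _ = ⊤
... | inj₂ _ | inj₁ _ = ⊥

_*ᴾ_ : (P₂ P₁ : FinPoset) → Rel (Fin (FinPoset.size P₁ Data.Nat.+ FinPoset.size P₂)) 0ℓ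
P₂ *ᴾ P₁ = starRel (FinPoset._≼_ P₁) (FinPoset._≼_ P₂)

-- A family of subsets of [n] (ordered by inclusion), without repetitions.
Family : ℕ → Set
Family n = List (Subset n)

ContainsInduced : ∀ {n k} → Family n → Rel (Fin k) 0ℓ → Set
ContainsInduced {n} {k} F R =
  Σ (Fin k → Subset n) λ f →
    Injective _≡_ _≡_ f ×
    (∀ x → f x ∈ F) ×
    (∀ x y → (f x ⊆ f y) ⇔ R x y)

Saturated : ∀ {n k} → Family n → Rel (Fin k) 0ℓ → Set
Saturated {n} F R =
  ¬ ContainsInduced F R ×
  (∀ (S : Subset n) → S ∉ F → ContainsInduced (S ∷ F) R)

module _ (P : FinPoset) where
  open FinPoset P

  _≺_ : Rel (Fin size) 0ℓ
  x ≺ y = x ≼ y × x ≢ y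

  Covers : Fin size → Fin size → Set
  Covers y x = x ≺ y × ¬ (∃[ z ] (x ≺ z × z ≺ y))

  Comparable : Fin size → Fin size → Set
  Comparable a b = a ≼ b ⊎ b ≼ a

  UCTP : Set
  UCTP = ∀ p₁ p₂ → Covers p₂ p₁ →
    ∃[ p₃ ] ((Comparable p₃ p₁ × ¬ Comparable p₃ p₂) ⊎
             (¬ Comparable p₃ p₁ × Comparable p₃ p₂))

SatStarAtLeast : ∀ {k} → ℕ → Rel (Fin k) 0ℓ → ℕ → Set
SatStarAtLeast n R K = (F : Family n) → Unique F → Saturated F R → K ≤ length F

{-# OPTIONS --safe #-}

-- If F is a saturated family with 2 ^ |F| < n, some i ≢ j lie in exactly the
-- same members of F, so toggling i in a member of F gives a set outside F.
-- By duality let P₁ have the UCTP and at least two elements.  Suppose some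
-- member of F avoids i, and take A maximal among those with no copy of P₁ in
-- F below A.  In a copy of P₂ * P₁ in F ∪ {A ∪ {i}} the new set must lie in
-- the P₁ part, and there it is related to every other element exactly as A is:
-- this contradicts the UCTP if A is used as well, and otherwise A can replace
-- the new set.  If all members of F contain i, a minimal B ∈ F and B \ {i}
-- play the same roles.
module Submission where

open import Defs
open import Data.Bool using (not)
open import Data.Bool.Properties using (¬-not) renaming (_≟_ to _≟ᵇ_)
open import Data.Fin using (Fin; zero; suc; splitAt; join; _↑ˡ_; _↑ʳ_; funToFin; finToFun)
open import Data.Fin.Properties using
  (_≟_; any?; splitAt-↑ˡ; splitAt-↑ʳ; join-splitAt; pigeonhole; finToFun-funToFin; 2↔Bool; <⇒≢)
open import Data.Fin.Subset using (Subset; _⊆_; _⊂_)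
  renaming (_∈_ to _∈ˢ_; _∉_ to _∉ˢ_; ⊥ to ∅)
open import Data.Fin.Subset.Induction using (⊂-wellFounded; ⊃-wellFounded)
open import Data.Fin.Subset.Properties using (⊆-isPartialOrder; _∈?_)
open import Data.List using (length) renaming (lookup to lookupᴸ)
open import Data.List.Membership.Propositional using (_∈_; _∉_)
open import Data.List.Relation.Unary.Any using (here; there; index)
open import Data.List.Relation.Unary.Any.Properties using (lookup-index)
open import Data.Nat using (ℕ; _≤_; _<_; _+_; _^_; s≤s)
open import Data.Nat.Properties using (_≤?_; ≰⇒>; ^-monoʳ-<; <-≤-trans; ≤-refl)
open import Data.Product using (_×_; _,_; proj₁; proj₂; ∃-syntax)
open import Data.Sum using (_⊎_; inj₁; inj₂; [_,_]; [_,_]′; swap)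
open import Data.Empty using (⊥-elim)
open import Data.Unit using (tt)
open import Data.Vec using (lookup; updateAt)
open import Data.Vec.Properties using
  (≡-dec; lookup⇒[]=; []=⇒lookup; updateAt-updates; updateAt-minimal; lookup∘updateAt′)
open import Function using (_∘_; flip)
open import Function.Bundles using (_⇔_; mk⇔; Equivalence; Inverse; Injection)
open import Function.Properties.Inverse using (↔-sym; ↔⇒↣)
open import Function.Properties.Equivalence using ()
  renaming (sym to ⇔-sym; trans to ⇔-trans)
open import Induction.WellFounded using (WellFounded; Acc; acc; module Subrelation)
open import Level using (0ℓ)
open import Relation.Binary.Core using (Rel)
open import Relation.Binary.Definitions using (DecidableEquality; Antisymmetric)
open import Relation.Binary.Structures using (IsPartialOrder)
import Relation.Binary.Construct.Flip.EqAndOrd as Flip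
open import Relation.Binary.PropositionalEquality using (_≡_; _≢_; refl; sym; trans; cong; subst)
open import Relation.Nullary using (¬_; yes; no; contradiction)
open import Relation.Nullary.Decidable using (_×-dec_; ¬?; decidable-stable; toSum)
open import Relation.Unary using (Pred)

open Equivalence using (to; from)

-- Twin-free relations and the UCTP.

Strict : {X : Set} → Rel X 0ℓ → Rel X 0ℓ
Strict _⊑_ x y = x ⊑ y × x ≢ y

Alike : {X : Set} → Rel X 0ℓ → X → X → X → Set
Alike _⊑_ p q x = (x ⊑ p ⇔ x ⊑ q) × (p ⊑ x ⇔ q ⊑ x)

-- The form in which the UCTP is applied: it speaks of `R p q` instead of covers, and it is stable
-- under reversing `R`.
TwinFree : {I : Set} → Rel I 0ℓ → Set
TwinFree R = ∀ {p q} → p ≢ q → R p q → ¬ (∀ x → x ≢ p → x ≢ q → Alike R p q x)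

twinFree-flip : {I : Set} {R : Rel I 0ℓ} → TwinFree R → TwinFree (flip R)
twinFree-flip tf p≢q qRp alike =
  tf (p≢q ∘ sym) qRp λ x x≢q x≢p →
    let below , above = alike x x≢p x≢q in ⇔-sym above , ⇔-sym below

-- Alike elements `p ≼ q` form a cover: a `z` strictly between them has `z ≼ q`, hence `z ≼ p`,
-- which is absurd. They are comparable with the same elements, so the UCTP fails at this cover.
uctp⇒twinFree : (P : FinPoset) → UCTP P → TwinFree (FinPoset._≼_ P)
uctp⇒twinFree P uctp {p} {q} p≢q p≼q alike = twins (uctp p q ((p≼q , p≢q) , between))
  where
  open FinPoset P
  open IsPartialOrder isPartialOrder using (antisym) renaming (refl to ≼-refl)

  between : ¬ (∃[ z ] (_≺_ P p z × _≺_ P z q))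
  between (z , (p≼z , p≢z) , (z≼q , z≢q)) =
    p≢z (antisym p≼z (from (proj₁ (alike z (p≢z ∘ sym) z≢q)) z≼q))

  comparable : ∀ x → Comparable P x p ⇔ Comparable P x q
  comparable x with x ≟ p | x ≟ q
  ... | yes refl | _        = mk⇔ (λ _ → inj₁ p≼q) (λ _ → inj₁ ≼-refl)
  ... | no _     | yes refl = mk⇔ (λ _ → inj₁ ≼-refl) (λ _ → inj₂ p≼q)
  ... | no x≢p   | no x≢q   = let below , above = alike x x≢p x≢q in
    mk⇔ [ inj₁ ∘ to below , inj₂ ∘ to above ] [ inj₁ ∘ from below , inj₂ ∘ from above ]

  twins : ¬ (∃[ x ] ((Comparable P x p × ¬ Comparable P x q) ⊎
                     (¬ Comparable P x p × Comparable P x q)))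
  twins (x , inj₁ (c , ¬c)) = ¬c (to (comparable x) c)
  twins (x , inj₂ (¬c , c)) = ¬c (from (comparable x) c)

-- Copies of a poset, and copies of `P₂ * P₁` as a lower and an upper part.

record Embeds {X I : Set} (_⊑_ : Rel X 0ℓ) (R : Rel I 0ℓ) (F : Pred X 0ℓ) (f : I → X) : Set where
  field
    member : ∀ x → F (f x)
    order  : ∀ x y → f x ⊑ f y ⇔ R x y

open Embeds

embeds-map : {X I : Set} {_⊑_ : Rel X 0ℓ} {R : Rel I 0ℓ} {F G : Pred X 0ℓ} {f : I → X} →
  (∀ x → F (f x) → G (f x)) → Embeds _⊑_ R F f → Embeds _⊑_ R G f
embeds-map F⊆G e = record { member = λ x → F⊆G x (member e x) ; order = order e }

record Stack {X I₁ I₂ : Set} (_⊑_ : Rel X 0ℓ) (R₁ : Rel I₁ 0ℓ) (R₂ : Rel I₂ 0ℓ)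
             (F : Pred X 0ℓ) : Set where
  field
    low         : I₁ → X
    high        : I₂ → X
    low-embeds  : Embeds _⊑_ R₁ F low
    high-embeds : Embeds _⊑_ R₂ F high
    low⊏high    : ∀ x y → Strict _⊑_ (low x) (high y)

embeds-flip : {X I : Set} {_⊑_ : Rel X 0ℓ} {R : Rel I 0ℓ} {F : Pred X 0ℓ} {f : I → X} →
  Embeds _⊑_ R F f → Embeds (flip _⊑_) (flip R) F f
embeds-flip e = record { member = member e ; order = λ x y → order e y x }

-- Reversing the order exchanges the two parts, which turns the case of a UCTP in `P₂` into the case
-- of `P₁`.
stack-flip : {X I₁ I₂ : Set} {_⊑_ : Rel X 0ℓ} {R₁ : Rel I₁ 0ℓ} {R₂ : Rel I₂ 0ℓ} {F : Pred X 0ℓ} →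
  Stack _⊑_ R₁ R₂ F → Stack (flip _⊑_) (flip R₂) (flip R₁) F
stack-flip s = record
  { low = high ; high = low
  ; low-embeds = embeds-flip high-embeds ; high-embeds = embeds-flip low-embeds
  ; low⊏high = λ x y → let l⊑h , l≢h = low⊏high y x in l⊑h , l≢h ∘ sym }
  where open Stack s

-- Adding one set, and families that do not separate two elements.

_∪｛_｝ : {X : Set} → Pred X 0ℓ → X → Pred X 0ℓ
(F ∪｛ s ｝) x = x ≡ s ⊎ F x

-- What remains of two elements i, j lying in the same members of F: Lo and Hi
-- are the sets avoiding and containing i, and toggle changes membership of i.
-- The axioms are invariant under reversing the order.
record Unseparated {X : Set} (_⊑_ : Rel X 0ℓ) (F : Pred X 0ℓ) : Set₁ where
  field
    isPartialOrder : IsPartialOrder _≡_ _⊑_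
    ⊏-wf     : WellFounded (Strict _⊑_)
    ⊐-wf     : WellFounded (Strict (flip _⊑_))
    Lo Hi    : Pred X 0ℓ
    side     : ∀ x → Lo x ⊎ Hi x
    lo-down  : ∀ {x y} → x ⊑ y → Lo y → Lo x
    hi-up    : ∀ {x y} → x ⊑ y → Hi x → Hi y
    toggle   : X → X
    toggle-∉ : ∀ {x} → F x → ¬ F (toggle x)
    lo-⊑     : ∀ {x} → Lo x → x ⊑ toggle x
    hi-⊑     : ∀ {x} → Hi x → toggle x ⊑ x
    lo-below : ∀ {x y} → F x → Lo x → F y → y ⊑ toggle x → y ⊑ x
    hi-above : ∀ {x y} → F x → Hi x → F y → toggle x ⊑ y → x ⊑ y
    lo-above : ∀ {x y} → Lo x → Hi y → x ⊑ y → toggle x ⊑ y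
    hi-below : ∀ {x y} → Hi x → Lo y → y ⊑ x → y ⊑ toggle x

unseparated-flip : {X : Set} {_⊑_ : Rel X 0ℓ} {F : Pred X 0ℓ} →
  Unseparated _⊑_ F → Unseparated (flip _⊑_) F
unseparated-flip u = record
  { isPartialOrder = Flip.isPartialOrder isPartialOrder
  ; ⊏-wf = ⊐-wf ; ⊐-wf = ⊏-wf
  ; Lo = Hi ; Hi = Lo ; side = swap ∘ side ; lo-down = hi-up ; hi-up = lo-down
  ; toggle = toggle ; toggle-∉ = toggle-∉ ; lo-⊑ = hi-⊑ ; hi-⊑ = lo-⊑
  ; lo-below = hi-above ; hi-above = lo-below
  ; lo-above = hi-below ; hi-below = lo-above }
  where open Unseparated u

-- Replacing one element of a copy.

module _ {X I : Set} (_≟ᴵ_ : DecidableEquality I) where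

  replace : (I → X) → I → X → I → X
  replace f p a x with x ≟ᴵ p
  ... | yes _ = a
  ... | no _  = f x

  replace-elim : (C : Pred X 0ℓ) (f : I → X) (p : I) (a : X) →
    C a → (∀ x → x ≢ p → C (f x)) → ∀ x → C (replace f p a x)
  replace-elim C f p a ca cf x with x ≟ᴵ p
  ... | yes _  = ca
  ... | no x≢p = cf x x≢p

module _ {X : Set} {_⊑_ : Rel X 0ℓ} (isPartialOrder : IsPartialOrder _≡_ _⊑_)
         {I : Set} {R : Rel I 0ℓ} where

  open IsPartialOrder isPartialOrder using (reflexive) renaming (refl to ⊑-refl)

  embeds-injective : Antisymmetric _≡_ R → {F : Pred X 0ℓ} {f : I → X} → Embeds _⊑_ R F f →
    ∀ {x y} → f x ≡ f y → x ≡ y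
  embeds-injective antisym e {x} {y} fx≡fy =
    antisym (to (order e x y) (reflexive fx≡fy)) (to (order e y x) (reflexive (sym fx≡fy)))

  module _ (_≟ᴵ_ : DecidableEquality I) where

    replace-embeds : {F G : Pred X 0ℓ} {f : I → X} (p : I) (a : X) → Embeds _⊑_ R F f →
      G a → (∀ x → x ≢ p → G (f x)) → (∀ x → x ≢ p → Alike _⊑_ (f p) a (f x)) →
      Embeds _⊑_ R G (replace _≟ᴵ_ f p a)
    replace-embeds {G = G} {f} p a e ga gf alike = record
      { member = replace-elim _≟ᴵ_ G f p a ga gf ; order = ord }
      where
      ord : ∀ x y → replace _≟ᴵ_ f p a x ⊑ replace _≟ᴵ_ f p a y ⇔ R x y
      ord x y with x ≟ᴵ p | y ≟ᴵ p
      ... | yes refl | yes refl = mk⇔ (λ _ → to (order e p p) ⊑-refl) (λ _ → ⊑-refl)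
      ... | yes refl | no y≢p   = ⇔-trans (⇔-sym (proj₂ (alike y y≢p))) (order e x y)
      ... | no x≢p   | yes refl = ⇔-trans (⇔-sym (proj₁ (alike x x≢p))) (order e x y)
      ... | no _     | no _     = order e x y

  twinFree-image : Antisymmetric _≡_ R → TwinFree R → {F : Pred X 0ℓ} {f : I → X} →
    Embeds _⊑_ R F f → ∀ {p q} → p ≢ q → R p q →
    ¬ (∀ x → x ≢ p → x ≢ q → Alike _⊑_ (f p) (f q) (f x))
  twinFree-image antisym tf e {p} {q} p≢q pRq alike = tf p≢q pRq λ x x≢p x≢q →
    let below , above = alike x x≢p x≢q in
    ⇔-trans (⇔-sym (order e x p)) (⇔-trans below (order e x q)) ,
    ⇔-trans (⇔-sym (order e p x)) (⇔-trans above (order e q x))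

-- The saturation argument, with the UCTP in the lower part.

module Saturation
  {X : Set} {_⊑_ : Rel X 0ℓ} {F : Pred X 0ℓ} (_≟ˣ_ : DecidableEquality X)
  (unseparated : Unseparated _⊑_ F)
  {k : ℕ} {I₂ : Set} {R₁ : Rel (Fin k) 0ℓ} {R₂ : Rel I₂ 0ℓ}
  (R₁-antisym : Antisymmetric _≡_ R₁) (twinFree : TwinFree R₁)
  {a₀ a₁ : Fin k} (a₀≢a₁ : a₀ ≢ a₁)
  (free : ¬ Stack _⊑_ R₁ R₂ F) (saturated : ∀ s → ¬ F s → Stack _⊑_ R₁ R₂ (F ∪｛ s ｝))
  where

  open Unseparated unseparated
  open IsPartialOrder isPartialOrder using (antisym) renaming (refl to ⊑-refl; trans to ⊑-trans)
  open Stack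

  _⊏_ : Rel X 0ℓ
  _⊏_ = Strict _⊑_

  ⊑-⊏-trans : ∀ {x y z} → x ⊑ y → y ⊏ z → x ⊏ z
  ⊑-⊏-trans x⊑y (y⊑z , y≢z) = ⊑-trans x⊑y y⊑z , λ { refl → y≢z (antisym y⊑z x⊑y) }

  old : ∀ {s x} → (F ∪｛ s ｝) x → x ≢ s → F x
  old (inj₁ x≡s) x≢s = contradiction x≡s x≢s
  old (inj₂ fx)  _   = fx

  not-constant : ∀ {G : Pred X 0ℓ} {f a} → Embeds _⊑_ R₁ G f → ¬ (∀ x → f x ≡ a)
  not-constant e const =
    a₀≢a₁ (embeds-injective isPartialOrder R₁-antisym e (trans (const a₀) (sym (const a₁))))

  -- A copy that uses `s` in neither part would lie in `F`, against `free`.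
  new∈low : ∀ {s} (c : Stack _⊑_ R₁ R₂ (F ∪｛ s ｝)) → (∀ y → F (high c y)) → ∃[ p ] low c p ≡ s
  new∈low {s} c high∈F with any? (λ x → low c x ≟ˣ s)
  ... | yes found = found
  ... | no ∄s = ⊥-elim (free record
    { low = low c ; high = high c ; low⊏high = low⊏high c
    ; low-embeds  = embeds-map (λ x m → old m (λ eq → ∄s (x , eq))) (low-embeds c)
    ; high-embeds = embeds-map (λ y _ → high∈F y) (high-embeds c) })

  -- If the lower part omits `a`, putting `a` in the place of `s` gives a copy inside `F`; `a⊏high`
  -- keeps it under the upper part. If it uses `a`, the positions of `s` and `a` are twins in `R₁`.
  no-alike : ∀ {s a} → ¬ F s → F a → s ⊑ a ⊎ a ⊑ s →
    (c : Stack _⊑_ R₁ R₂ (F ∪｛ s ｝)) → (∀ y → F (high c y)) → (∀ y → a ⊏ high c y) →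
    ¬ (∀ x → F (low c x) → low c x ≢ a → Alike _⊑_ s a (low c x))
  no-alike {s} {a} s∉F a∈F s∥a c high∈F a⊏high alike with new∈low c high∈F
  ... | p , p≡s with any? (λ x → low c x ≟ˣ a)
  ...   | no ∄a = free record
    { low = replace _≟_ (low c) p a ; high = high c
    ; low-embeds  = replace-embeds isPartialOrder _≟_ p a (low-embeds c) a∈F low∈F
        λ x x≢p → alike-p x (low∈F x x≢p) (λ eq → ∄a (x , eq))
    ; high-embeds = embeds-map (λ y _ → high∈F y) (high-embeds c)
    ; low⊏high = λ x y → replace-elim _≟_ (_⊏ high c y) (low c) p a (a⊏high y)
        (λ z _ → low⊏high c z y) x }
    where
    alike-p : ∀ x → F (low c x) → low c x ≢ a → Alike _⊑_ (low c p) a (low c x)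
    alike-p = subst (λ t → ∀ x → F (low c x) → low c x ≢ a → Alike _⊑_ t a (low c x)) (sym p≡s) alike
    low∈F : ∀ x → x ≢ p → F (low c x)
    low∈F x x≢p = old (member (low-embeds c) x) λ x≡s →
      x≢p (embeds-injective isPartialOrder R₁-antisym (low-embeds c) (trans x≡s (sym p≡s)))
  -- `TwinFree` needs the two positions in increasing order, and `s∥a` may give either order, so
  -- `twins` is applied in both directions.
  ...   | yes (q , refl) = [ twins p≢q alike-pq , twins (p≢q ∘ sym) (λ x x≢q x≢p →
            let below , above = alike-pq x x≢p x≢q in ⇔-sym below , ⇔-sym above) ]
          (subst (λ t → t ⊑ low c q ⊎ low c q ⊑ t) (sym p≡s) s∥a)
    where
    e = low-embeds c
    inj = embeds-injective isPartialOrder R₁-antisym e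
    p≢q : p ≢ q
    p≢q refl = s∉F (subst F p≡s a∈F)
    twins : ∀ {p q} → p ≢ q → (∀ x → x ≢ p → x ≢ q → Alike _⊑_ (low c p) (low c q) (low c x)) →
      ¬ (low c p ⊑ low c q)
    twins p≢q al p⊑q =
      twinFree-image isPartialOrder R₁-antisym twinFree e p≢q (to (order e _ _) p⊑q) al
    alike-pq : ∀ x → x ≢ p → x ≢ q → Alike _⊑_ (low c p) (low c q) (low c x)
    alike-pq x x≢p x≢q = subst (λ t → Alike _⊑_ t (low c q) (low c x)) (sym p≡s)
      (alike x (old (member e x) λ x≡s → x≢p (inj (trans x≡s (sym p≡s)))) (x≢q ∘ inj))

  CopyBelow : X → Set
  CopyBelow a = ∃[ f ] Embeds _⊑_ R₁ (λ x → F x × x ⊑ a) f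

  -- The choice of a maximal counterexample becomes induction from above: strictly larger members in
  -- `Lo` already have copies below them. Existence of a copy is not decided here, and the double
  -- negation suffices because every use of it derives a contradiction.
  ¬lo-above : ∀ {a} → Acc (Strict (flip _⊑_)) a → F a → Lo a → ¬ ¬ CopyBelow a
  ¬lo-above {a} (acc larger) a∈F lo ∄copy =
    no-alike s∉F a∈F (inj₂ a⊑s) c high∈F
      (λ y → ⊑-⊏-trans a⊑s (subst (_⊏ high c y) (proj₂ (new∈low c high∈F)) (low⊏high c _ y))) alike
    where
    s = toggle a
    s∉F = toggle-∉ a∈F
    a⊑s = lo-⊑ lo
    c = saturated s s∉F

    -- If `s` were in the upper part, the whole lower part would be members below `s`, hence below
    -- `a` by `lo-below`: a copy that `∄copy` forbids.
    high≢s : ∀ y → high c y ≢ s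
    high≢s y y≡s = ∄copy (low c , embeds-map
      (λ x m → let x⊑s , x≢s = subst (low c x ⊏_) y≡s (low⊏high c x y) ; x∈F = old m x≢s in
        x∈F , lo-below a∈F lo x∈F x⊑s) (low-embeds c))

    high∈F : ∀ y → F (high c y)
    high∈F y = old (member (high-embeds c) y) (high≢s y)

    -- A copy of P₁ below low c x combines with the P₂ part of c to a copy in F.
    ¬lo : ∀ x → F (low c x) → low c x ≢ a → a ⊑ low c x → ¬ Lo (low c x)
    ¬lo x x∈F x≢a a⊑x lo-x = ¬lo-above (larger (a⊑x , x≢a)) x∈F lo-x λ (g , e) → free record
      { low = g ; high = high c
      ; low-embeds  = embeds-map (λ _ → proj₁) e
      ; high-embeds = embeds-map (λ y _ → high∈F y) (high-embeds c)
      ; low⊏high = λ z y → ⊑-⊏-trans (proj₂ (member e z)) (low⊏high c x y) }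

    alike : ∀ x → F (low c x) → low c x ≢ a → Alike _⊑_ s a (low c x)
    -- The one delicate direction is from `a ⊑ x` to `s ⊑ x`: `¬lo` forces `x` into `Hi`, where
    -- `lo-above` applies.
    alike x x∈F x≢a =
      mk⇔ (lo-below a∈F lo x∈F) (λ x⊑a → ⊑-trans x⊑a a⊑s) ,
      mk⇔ (⊑-trans a⊑s) λ a⊑x →
        [ ⊥-elim ∘ ¬lo x x∈F x≢a a⊑x , (λ hi → lo-above lo hi a⊑x) ]′ (side (low c x))

  -- Induction from below lets `a` be minimal among members in `Lo`. Members below `a` are again in
  -- `Lo`, so only `a` itself remains, and a copy of `R₁` below `a` would be constant although `R₁`
  -- has two distinct points.
  ¬lo-member : ∀ {a} → Acc _⊏_ a → F a → ¬ Lo a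
  ¬lo-member {a} (acc smaller) a∈F lo = ¬lo-above (⊐-wf a) a∈F lo λ (f , e) →
    not-constant e λ x → let x∈F , x⊑a = member e x in
      minimal x∈F x⊑a
    where
    minimal : ∀ {x} → F x → x ⊑ a → x ≡ a
    minimal {x} x∈F x⊑a with x ≟ˣ a
    ... | yes x≡a = x≡a
    ... | no x≢a  = ⊥-elim (¬lo-member (smaller (x⊑a , x≢a)) x∈F (lo-down x⊑a lo))

  hi-member : ∀ {a} → F a → Hi a
  hi-member {a} a∈F = [ ⊥-elim ∘ ¬lo-member (⊏-wf a) a∈F , (λ hi → hi) ] (side a)

  -- Every member is now in `Hi`. Induction from below lets `a` be a minimal member, and `s` is `a`
  -- with `i` removed.
  ¬member : ∀ {a} → Acc _⊏_ a → ¬ F a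
  ¬member {a} (acc smaller) a∈F =
    no-alike s∉F a∈F (inj₁ s⊑a) c high∈F a⊏high alike
    where
    s = toggle a
    s∉F = toggle-∉ a∈F
    s⊑a = hi-⊑ (hi-member a∈F)
    c = saturated s s∉F

    minimal : ∀ {x} → F x → x ⊑ a → x ≡ a
    minimal {x} x∈F x⊑a with x ≟ˣ a
    ... | yes x≡a = x≡a
    ... | no x≢a  = ⊥-elim (¬member (smaller (x⊑a , x≢a)) x∈F)

    ¬below-s : ∀ {x} → F x → ¬ (x ⊑ s)
    ¬below-s x∈F x⊑s = s∉F (subst F (antisym x⊑s
      (subst (s ⊑_) (sym (minimal x∈F (⊑-trans x⊑s s⊑a))) s⊑a)) x∈F)

    -- The point `a₀` makes the lower part nonempty; its image would be a member below `s`.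
    high≢s : ∀ y → high c y ≢ s
    high≢s y y≡s = let x⊑s , x≢s = subst (low c a₀ ⊏_) y≡s (low⊏high c a₀ y) in
      ¬below-s (old (member (low-embeds c) a₀) x≢s) x⊑s

    high∈F : ∀ y → F (high c y)
    high∈F y = old (member (high-embeds c) y) (high≢s y)

    -- Under `a` the enlarged family offers only `s` as a strictly smaller element, so the lower
    -- part would be constant.
    high≢a : ∀ y → high c y ≢ a
    high≢a y y≡a = not-constant {a = s} (low-embeds c) λ x →
      let x⊑a , x≢a = subst (low c x ⊏_) y≡a (low⊏high c x y) in
      [ (λ eq → eq) , (λ x∈F → contradiction (minimal x∈F x⊑a) x≢a) ]′ (member (low-embeds c) x)

    a⊏high : ∀ y → a ⊏ high c y
    a⊏high y = hi-above a∈F (hi-member a∈F) (high∈F y)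
      (subst (_⊑ high c y) (proj₂ (new∈low c high∈F)) (proj₁ (low⊏high c _ y))) , high≢a y ∘ sym

    alike : ∀ x → F (low c x) → low c x ≢ a → Alike _⊑_ s a (low c x)
    alike x x∈F x≢a =
      mk⇔ (⊥-elim ∘ ¬below-s x∈F) (λ x⊑a → contradiction (minimal x∈F x⊑a) x≢a) ,
      mk⇔ (hi-above a∈F (hi-member a∈F) x∈F) (⊑-trans s⊑a)

  -- With `F` empty, a copy in the family enlarged by `s` has all its lower elements equal to `s`.
  -- Any inhabitant of `X` thus refutes the assumptions of the module.
  X-empty : ¬ X
  X-empty s = not-constant (low-embeds c) λ x →
    [ (λ eq → eq) , ⊥-elim ∘ s∉F ]′ (member (low-embeds c) x)
    where
    s∉F : ∀ {x} → ¬ F x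
    s∉F {x} = ¬member (⊏-wf x)
    c = saturated s s∉F

-- Translation between induced copies of the star poset and stacks.

module _ {k₁ k₂ : ℕ} (R₁ : Rel (Fin k₁) 0ℓ) (R₂ : Rel (Fin k₂) 0ℓ) where

  starRel-low-low : ∀ x y → starRel R₁ R₂ (x ↑ˡ k₂) (y ↑ˡ k₂) ≡ R₁ x y
  starRel-low-low x y rewrite splitAt-↑ˡ k₁ x k₂ | splitAt-↑ˡ k₁ y k₂ = refl

  starRel-high-high : ∀ x y → starRel R₁ R₂ (k₁ ↑ʳ x) (k₁ ↑ʳ y) ≡ R₂ x y
  starRel-high-high x y rewrite splitAt-↑ʳ k₁ k₂ x | splitAt-↑ʳ k₁ k₂ y = refl

  starRel-low-high : ∀ x y → starRel R₁ R₂ (x ↑ˡ k₂) (k₁ ↑ʳ y)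
  starRel-low-high x y rewrite splitAt-↑ˡ k₁ x k₂ | splitAt-↑ʳ k₁ k₂ y = tt

  starRel-high-low : ∀ x y → ¬ starRel R₁ R₂ (k₁ ↑ʳ x) (y ↑ˡ k₂)
  starRel-high-low x y rewrite splitAt-↑ʳ k₁ k₂ x | splitAt-↑ˡ k₁ y k₂ = λ ()

  contains⇒stack : ∀ {n} {F : Family n} →
    ContainsInduced F (starRel R₁ R₂) → Stack _⊆_ R₁ R₂ (_∈ F)
  contains⇒stack (f , _ , f∈F , ord) = record
    { low = λ x → f (x ↑ˡ k₂) ; high = λ y → f (k₁ ↑ʳ y)
    ; low-embeds  = record { member = λ x → f∈F (x ↑ˡ k₂)
      ; order = λ x y → subst (_ ⇔_) (starRel-low-low x y) (ord (x ↑ˡ k₂) (y ↑ˡ k₂)) }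
    ; high-embeds = record { member = λ y → f∈F (k₁ ↑ʳ y)
      ; order = λ x y → subst (_ ⇔_) (starRel-high-high x y) (ord (k₁ ↑ʳ x) (k₁ ↑ʳ y)) }
    ; low⊏high = λ x y → from (ord _ _) (starRel-low-high x y) ,
        λ eq → starRel-high-low y x (to (ord _ _) (IsPartialOrder.reflexive (⊆-isPartialOrder _) (sym eq))) }

  stack⇒contains : ∀ {n} {F : Family n} → Antisymmetric _≡_ R₁ → Antisymmetric _≡_ R₂ →
    Stack _⊆_ R₁ R₂ (_∈ F) → ContainsInduced F (starRel R₁ R₂)
  stack⇒contains {n} {F} antisym₁ antisym₂ s = f , injective , f∈F , ord
    where
    open Stack s
    open IsPartialOrder (⊆-isPartialOrder n) using (antisym)

    f : Fin (k₁ + k₂) → Subset n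
    f x = [ low , high ] (splitAt k₁ x)

    f∈F : ∀ x → f x ∈ F
    f∈F x with splitAt k₁ x
    ... | inj₁ a = member low-embeds a
    ... | inj₂ b = member high-embeds b

    ord : ∀ x y → (f x ⊆ f y) ⇔ starRel R₁ R₂ x y
    ord x y with splitAt k₁ x | splitAt k₁ y
    ... | inj₁ a | inj₁ b = order low-embeds a b
    ... | inj₂ a | inj₂ b = order high-embeds a b
    ... | inj₁ a | inj₂ b = mk⇔ (λ _ → tt) (λ _ {x} → proj₁ (low⊏high a b) {x})
    ... | inj₂ a | inj₁ b =
      mk⇔ (λ (h⊆l : high a ⊆ low b) → proj₂ (low⊏high b a) (antisym (proj₁ (low⊏high b a)) h⊆l)) λ ()

    [low,high]-injective : ∀ u v → [ low , high ] u ≡ [ low , high ] v → u ≡ v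
    [low,high]-injective (inj₁ a) (inj₁ b) eq =
      cong inj₁ (embeds-injective (⊆-isPartialOrder _) antisym₁ low-embeds eq)
    [low,high]-injective (inj₂ a) (inj₂ b) eq =
      cong inj₂ (embeds-injective (⊆-isPartialOrder _) antisym₂ high-embeds eq)
    [low,high]-injective (inj₁ a) (inj₂ b) eq = contradiction eq (proj₂ (low⊏high a b))
    [low,high]-injective (inj₂ a) (inj₁ b) eq = contradiction (sym eq) (proj₂ (low⊏high b a))

    injective : ∀ {x y} → f x ≡ f y → x ≡ y
    injective {x} {y} eq = trans (sym (join-splitAt k₁ k₂ x))
      (trans (cong (join k₁ k₂) ([low,high]-injective (splitAt k₁ x) (splitAt k₁ y) eq))
        (join-splitAt k₁ k₂ y))

stack-map : {X I₁ I₂ : Set} {_⊑_ : Rel X 0ℓ} {R₁ : Rel I₁ 0ℓ} {R₂ : Rel I₂ 0ℓ} {F G : Pred X 0ℓ} →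
  (∀ {x} → F x → G x) → Stack _⊑_ R₁ R₂ F → Stack _⊑_ R₁ R₂ G
stack-map F⊆G s = record
  { low = low ; high = high ; low⊏high = low⊏high
  ; low-embeds = embeds-map (λ _ → F⊆G) low-embeds
  ; high-embeds = embeds-map (λ _ → F⊆G) high-embeds }
  where open Stack s

-- Toggling an element of a subset.

⊆∧≢⇒⊂ : ∀ {n} {p q : Subset n} → p ⊆ q → p ≢ q → p ⊂ q
⊆∧≢⇒⊂ {p = p} {q} p⊆q p≢q with any? (λ x → (x ∈? q) ×-dec ¬? (x ∈? p))
... | yes q⊈p = p⊆q , q⊈p
... | no ∄ = contradiction (IsPartialOrder.antisym (⊆-isPartialOrder _) p⊆q
  (λ {x} x∈q → decidable-stable (x ∈? p) (λ x∉p → ∄ (x , x∈q , x∉p)))) p≢q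

module Toggle {n : ℕ} (i : Fin n) where

  toggle : Subset n → Subset n
  toggle p = updateAt p i not

  ∈-toggle⁺ : ∀ p {x} → x ≢ i → x ∈ˢ p → x ∈ˢ toggle p
  ∈-toggle⁺ p {x} x≢i = updateAt-minimal x i p x≢i

  ∈-toggle⁻ : ∀ p {x} → x ≢ i → x ∈ˢ toggle p → x ∈ˢ p
  ∈-toggle⁻ p {x} x≢i x∈Tp = lookup⇒[]= x p
    (trans (sym (lookup∘updateAt′ x i x≢i p)) ([]=⇒lookup x∈Tp))

  i∉p⇒i∈toggle : ∀ p → i ∉ˢ p → i ∈ˢ toggle p
  i∉p⇒i∈toggle p i∉p = updateAt-updates i p (lookup⇒[]= i p (¬-not (i∉p ∘ lookup⇒[]= i p)))

  i∈p⇒i∉toggle : ∀ p → i ∈ˢ p → i ∉ˢ toggle p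
  i∈p⇒i∉toggle p i∈p i∈Tp with () ← trans (sym ([]=⇒lookup i∈Tp)) ([]=⇒lookup (updateAt-updates i p i∈p))

  module _ {F : Pred (Subset n) 0ℓ} (j : Fin n) (j≢i : j ≢ i)
           (twins : ∀ {p} → F p → i ∈ˢ p ⇔ j ∈ˢ p) where

    -- Toggling changes membership of `i` but not of `j`, so `p` and `toggle p` cannot both satisfy
    -- `twins`.
    toggle-leaves : ∀ {p} → F p → ¬ F (toggle p)
    toggle-leaves {p} p∈F Tp∈F with i ∈? p
    ... | yes i∈p = i∈p⇒i∉toggle p i∈p (from (twins Tp∈F) (∈-toggle⁺ p j≢i (to (twins p∈F) i∈p)))
    ... | no i∉p = i∉p (from (twins p∈F) (∈-toggle⁻ p j≢i (to (twins Tp∈F) (i∉p⇒i∈toggle p i∉p))))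

    unseparated : Unseparated _⊆_ F
    unseparated = record
      { isPartialOrder = ⊆-isPartialOrder n
      ; ⊏-wf = Subrelation.wellFounded (λ (p⊆q , p≢q) → ⊆∧≢⇒⊂ p⊆q p≢q) ⊂-wellFounded
      ; ⊐-wf = Subrelation.wellFounded (λ (q⊆p , p≢q) → ⊆∧≢⇒⊂ q⊆p (p≢q ∘ sym)) ⊃-wellFounded
      ; Lo = i ∉ˢ_ ; Hi = i ∈ˢ_
      ; side = λ p → swap (toSum (i ∈? p))
      ; lo-down = λ p⊆q i∉q i∈p → i∉q (p⊆q i∈p)
      ; hi-up = λ p⊆q i∈p → p⊆q i∈p
      ; toggle = toggle
      ; toggle-∉ = toggle-leaves
      ; lo-⊑ = λ {p} i∉p {x} x∈p → ∈-toggle⁺ p (λ { refl → i∉p x∈p }) x∈p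
      ; hi-⊑ = λ {p} i∈p {x} x∈Tp → ∈-toggle⁻ p (λ { refl → i∈p⇒i∉toggle p i∈p x∈Tp }) x∈Tp
      -- Only `x = i` matters: `i` in `q` gives `j` in `q`, so `j` in `toggle p` and in `p`, and
      -- then `i` in `p`.
      ; lo-below = λ {p} p∈F i∉p q∈F q⊆Tp {x} x∈q → ∈-toggle⁻ p
          (λ { refl → i∉p (from (twins p∈F) (∈-toggle⁻ p j≢i (q⊆Tp (to (twins q∈F) x∈q)))) })
          (q⊆Tp x∈q)
      -- Dually, `j` survives the removal of `i` from `p`, so it lies in `q` and brings `i` with it.
      ; hi-above = λ {p} {q} p∈F i∈p q∈F Tp⊆q {x} x∈p → atOrAway
          (from (twins q∈F) (Tp⊆q (∈-toggle⁺ p j≢i (to (twins p∈F) i∈p))))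
          (λ x≢i → Tp⊆q (∈-toggle⁺ p x≢i x∈p))
      ; lo-above = λ {p} {q} i∉p i∈q p⊆q {x} x∈Tp → atOrAway
          i∈q (λ x≢i → p⊆q (∈-toggle⁻ p x≢i x∈Tp))
      ; hi-below = λ {p} i∈p i∉q q⊆p {x} x∈q → ∈-toggle⁺ p (λ { refl → i∉q x∈q }) (q⊆p x∈q)
      }
      where
      atOrAway : ∀ {q x} → i ∈ˢ q → (x ≢ i → x ∈ˢ q) → x ∈ˢ q
      atOrAway {x = x} at away with x ≟ i
      ... | yes refl = at
      ... | no x≢i   = away x≢i

-- Two points that no member of a small family separates.

twin-points : ∀ {n} (F : Family n) → 2 ^ length F < n →
  ∃[ i ] ∃[ j ] (j ≢ i × (∀ {p} → p ∈ F → i ∈ˢ p ⇔ j ∈ˢ p))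
-- The column of a point records which members contain it. `funToFin` codes columns as elements of
-- `Fin (2 ^ length F)`, so two of the `n` points share a column.
twin-points {n} F 2^∣F∣<n with pigeonhole 2^∣F∣<n (funToFin ∘ column)
  where
  column : Fin n → Fin (length F) → Fin 2
  column i m = Inverse.from 2↔Bool (lookup (lookupᴸ F m) i)
... | i , j , i<j , eq = i , j , (<⇒≢ i<j ∘ sym) , λ {p} p∈F →
  let same = agree p∈F in
  mk⇔ (λ i∈p → lookup⇒[]= j p (trans (sym same) ([]=⇒lookup i∈p)))
      (λ j∈p → lookup⇒[]= i p (trans same ([]=⇒lookup j∈p)))
  where
  agree : ∀ {p} → p ∈ F → lookup p i ≡ lookup p j
  agree {p} p∈F = subst (λ q → lookup q i ≡ lookup q j) (sym (lookup-index p∈F))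
    (Injection.injective (↔⇒↣ (↔-sym 2↔Bool)) (trans (sym (finToFun-funToFin _ (index p∈F)))
      (trans (cong (λ c → finToFun c (index p∈F)) eq) (finToFun-funToFin _ (index p∈F)))))

distinct-elements : ∀ {k} → 2 ≤ k → ∃[ a ] ∃[ b ] (_≢_ {A = Fin k} a b)
distinct-elements (s≤s (s≤s _)) = zero , suc zero , λ ()

-- Both cases of the UCTP, and the bound.

unseparated⇒¬saturated : (P₁ P₂ : FinPoset) →
  (UCTP P₁ × 2 ≤ FinPoset.size P₁) ⊎ (UCTP P₂ × 2 ≤ FinPoset.size P₂) →
  ∀ {n} {F : Family n} → Unseparated _⊆_ (_∈ F) → ¬ Saturated F (P₂ *ᴾ P₁)
unseparated⇒¬saturated P₁ P₂ hyp {n} {F} unsep (free , sat) = absurd hyp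
  where
  open FinPoset P₁ using () renaming (_≼_ to R₁; isPartialOrder to po₁)
  open FinPoset P₂ using () renaming (_≼_ to R₂; isPartialOrder to po₂)

  free′ : ¬ Stack _⊆_ R₁ R₂ (_∈ F)
  free′ = free ∘ stack⇒contains R₁ R₂ (IsPartialOrder.antisym po₁) (IsPartialOrder.antisym po₂)

  sat′ : ∀ s → s ∉ F → Stack _⊆_ R₁ R₂ ((_∈ F) ∪｛ s ｝)
  sat′ s s∉F = stack-map (λ { (here eq) → inj₁ eq ; (there x∈F) → inj₂ x∈F })
    (contains⇒stack R₁ R₂ (sat s s∉F))

  absurd : ¬ ((UCTP P₁ × 2 ≤ FinPoset.size P₁) ⊎ (UCTP P₂ × 2 ≤ FinPoset.size P₂))
  absurd (inj₁ (uctp , 2≤)) = let a , b , a≢b = distinct-elements 2≤ in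
    Saturation.X-empty (≡-dec _≟ᵇ_) unsep (IsPartialOrder.antisym po₁)
      (uctp⇒twinFree P₁ uctp) a≢b free′ sat′ ∅
  -- In the reversed order `P₂` is the lower part, so the same module applies to the flipped data.
  absurd (inj₂ (uctp , 2≤)) = let a , b , a≢b = distinct-elements 2≤ in
    Saturation.X-empty (≡-dec _≟ᵇ_) (unseparated-flip unsep)
      (λ xRy yRx → IsPartialOrder.antisym po₂ yRx xRy)
      (twinFree-flip (uctp⇒twinFree P₂ uctp)) a≢b
      (free′ ∘ stack-flip) (λ s → stack-flip ∘ sat′ s) ∅

theorem2p3 : (P₁ P₂ : FinPoset) →
    (UCTP P₁ × 2 ≤ FinPoset.size P₁) ⊎ (UCTP P₂ × 2 ≤ FinPoset.size P₂) →
    ∀ (K : ℕ) → ∃[ N ] (∀ n → N ≤ n → SatStarAtLeast n (P₂ *ᴾ P₁) K)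
theorem2p3 P₁ P₂ hyp K = 2 ^ K , large
  where
  large : ∀ n → 2 ^ K ≤ n → SatStarAtLeast n (P₂ *ᴾ P₁) K
  large n 2^K≤n F _ sat with K ≤? length F
  ... | yes K≤∣F∣ = K≤∣F∣
  ... | no K≰∣F∣  =
    -- If `length F < K`, then `2 ^ length F < 2 ^ K ≤ n`; this is where the threshold `2 ^ K` comes
    -- from.
    let i , j , j≢i , twins = twin-points F (<-≤-trans (^-monoʳ-< 2 ≤-refl (≰⇒> K≰∣F∣)) 2^K≤n)
    in ⊥-elim (unseparated⇒¬saturated P₁ P₂ hyp (Toggle.unseparated i j j≢i twins) sat)
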